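{- Let $a,b\ge1$ be odd integers and let $n=3k-1$ for some integer $k\ge2$. Then the Horadam cube $\Pi^{a,b}_n$ is Hamiltonian.
   Context: For integers $a,b\ge1$ and $n\ge 0$, $\mathcal S^{a,b}_n$ is the set of all strings of length $n$ over the alphabet $\{0,1,\dots,a+b-1\}$ in which every letter from $\{a,\dots,a+b-1\}$ appears only immediately after a letter $0$. The Horadam cube $\Pi^{a,b}_n$ is the simple graph with vertex set $\mathcal S^{a,b}_n$ in which $x_1\cdots x_n$ and $y_1\cdots y_n$ are adjacent if and only if $\sum_{i=1}^n|x_i-y_i|=1$. A graph is Hamiltonian if it contains a cycle visiting each vertex exactly once. -}

module Defs where

open import Data.Fin.Base using (Fin; toℕ)
open import Data.List.Base using (List; _∷_; _∷ʳ_; length)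
open import Data.List.Membership.Propositional using (_∈_)
open import Data.List.Relation.Unary.Linked using (Linked)
open import Data.List.Relation.Unary.Unique.Propositional using (Unique)
open import Data.Nat.Base using (ℕ; suc; _+_; _≤_; ∣_-_∣)
open import Data.Nat.Properties using (∣-∣-comm; ∣n-n∣≡0)
open import Data.Product.Base using (_×_; ∃-syntax)
open import Data.Refinement.Base using (Refinement; value)
open import Data.Vec.Base using (Vec; []; _∷_; lookup; sum; zipWith)
open import Relation.Binary.Core using (Rel)
open import Relation.Binary.Definitions using (Symmetric)
open import Relation.Binary.PropositionalEquality
  using (_≡_; refl; sym; trans; cong₂)
open import Relation.Nullary.Negation.Core using (¬_)
open import Level using (0ℓ)

record SimpleGraph : Set₁ where
  field
    Vertex   : Set
    Adjacent : Rel Vertex 0ℓ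
    adj-sym  : Symmetric Adjacent
    no-loop  : ∀ {v} → ¬ Adjacent v v

-- The cycle v₀ v₁ … vₘ v₀ is given by its start v₀ and the list v₁ … vₘ;
-- a cycle in a simple graph has at least three vertices.
record Cycle (G : SimpleGraph) : Set where
  open SimpleGraph G
  field
    start    : Vertex
    rest     : List Vertex
    long     : 3 ≤ length (start ∷ rest)
    distinct : Unique (start ∷ rest)
    closed   : Linked Adjacent (start ∷ rest ∷ʳ start)

  vertices : List Vertex
  vertices = start ∷ rest

-- "Exactly once": at least once here, at most once by Cycle.distinct.
Hamiltonian : SimpleGraph → Set
Hamiltonian G = ∃[ C ] (∀ v → v ∈ Cycle.vertices {G} C)

Word : ℕ → ℕ → ℕ → Set
Word a b n = Vec (Fin (a + b)) n

-- In particular the first letter of an admissible word is less than a.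
Admissible : ∀ a b {n} → Word a b n → Set
Admissible a b x =
  ∀ i → a ≤ toℕ (lookup x i) →
  ∃[ j ] toℕ i ≡ suc (toℕ j) × toℕ (lookup x j) ≡ 0

-- Admissibility is recorded irrelevantly, so that two vertices are equal
-- as soon as their underlying words are.
𝒮 : ℕ → ℕ → ℕ → Set
𝒮 a b n = Refinement (Word a b n) (Admissible a b)

distance : ∀ {m n} → Vec (Fin m) n → Vec (Fin m) n → ℕ
distance x y = sum (zipWith (λ s t → ∣ toℕ s - toℕ t ∣) x y)

distance-comm : ∀ {m n} (x y : Vec (Fin m) n) → distance x y ≡ distance y x
distance-comm []      []      = refl
distance-comm (s ∷ x) (t ∷ y) =
  cong₂ _+_ (∣-∣-comm (toℕ s) (toℕ t)) (distance-comm x y)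

distance-refl : ∀ {m n} (x : Vec (Fin m) n) → distance x x ≡ 0
distance-refl []      = refl
distance-refl (s ∷ x) = cong₂ _+_ (∣n-n∣≡0 (toℕ s)) (distance-refl x)

HoradamCube : ℕ → ℕ → ℕ → SimpleGraph
HoradamCube a b n = record
  { Vertex   = 𝒮 a b n
  ; Adjacent = λ x y → distance (value x) (value y) ≡ 1
  ; adj-sym  = λ {x} {y} x~y →
      trans (distance-comm (value y) (value x)) x~y
  ; no-loop  = λ {x} x~x → 0≢1 (trans (sym (distance-refl (value x))) x~x)
  }
  where
  0≢1 : ¬ 0 ≡ 1
  0≢1 ()

{-# OPTIONS --safe #-}
module Submission where

-- Write 0 = o, a - 1 = e, a = f, a + b - 1 = g. The words of length n + 2 form a copies of the
-- cube of length n + 1 (indexed by the low first letter) and b copies of the cube of length n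
-- (words beginning with 0 c, c high), attached to the layer 0 (a - 1) of the former. As a and b
-- are odd, snaking through these copies gives by recursion a Hamiltonian path with ends
-- source (n + 2) = 0 g target (n) and target (n + 1) = e source (n). Modulo 2, the number of words
-- satisfies the Fibonacci recurrence, so it is even for length 2 mod 3.
-- For length n + 3 with n = 2 mod 3, the words 0 c x with c arbitrary and x of length n + 1
-- form an even number of copies of a path: go along the first one, snake through the others
-- without the first column, and return along that column. The missing words are reached on
-- detours: those beginning with 0 0 c, c high, are inserted into the copy c = 0 in pairs of
-- columns, because the number of words of length n is even; the layers 1, ..., a - 1, an even
-- number of copies of a Hamiltonian path, replace one edge of the copy c = a - 1.

open import Defs
import Algebra.Solver.CommutativeMonoid as CommutativeMonoidSolver
open import Data.Empty using (⊥)
open import Data.Fin.Base using (Fin; zero; suc; toℕ; fromℕ; splitAt; _↑ˡ_; _↑ʳ_)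
open import Data.Fin.Properties
  using (toℕ-fromℕ; toℕ-↑ˡ; toℕ-↑ʳ; toℕ<n; toℕ-injective; ↑ˡ-injective; ↑ʳ-injective; join-splitAt)
  renaming (_≟_ to _≟ᶠ_)
open import Data.Irrelevant using () renaming ([_] to ⟦_⟧)
open import Data.List.Base
  using (List; []; _∷_; [_]; _++_; _∷ʳ_; length; map; tabulate; allFin; cartesianProductWith)
open import Data.List.Properties
  using (length-map; length-++; length-tabulate; map-++; map-∘; map-tabulate)
import Data.List.Membership.DecPropositional as DecMembership
open import Data.List.Membership.Propositional using (_∈_)
open import Data.List.Membership.Propositional.Properties
  using ( ∈-allFin; ∈-map⁺; ∈-map⁻; ∈-++⁺ˡ; ∈-++⁺ʳ; ∈-++⁻
        ; ∈-cartesianProductWith⁺; ∈-cartesianProductWith⁻)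
open import Data.List.Relation.Binary.Permutation.Propositional
  using (_↭_; refl; prep; swap; trans; ↭-reflexive; ↭-sym; ↭-trans; ↭⇒↭ₛ; module PermutationReasoning)
open import Data.List.Relation.Binary.Permutation.Propositional.Properties
  using (++⁺; ++⁺ˡ; ++⁺ʳ; ++-comm; shifts; ↭-length; ++-commutativeMonoid; ∈-resp-↭; All-resp-↭)
  renaming (map⁺ to ↭-map⁺; ++-assoc to ↭-++-assoc; ++-identityʳ to ↭-++-identityʳ)
open import Data.List.Relation.Binary.Permutation.Setoid.Properties using (Unique-resp-↭)
open import Data.List.Relation.Unary.All as All using (All; []; _∷_)
open import Data.List.Relation.Unary.Any using (here)
open import Data.List.Relation.Unary.Linked as Linked using (Linked; [-]; _∷_)
import Data.List.Relation.Unary.Linked.Properties as Linked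
open import Data.List.Relation.Unary.Unique.Propositional using (Unique; []; _∷_)
import Data.List.Relation.Unary.Unique.Propositional.Properties as Unique
open import Data.Nat.Base
  using (ℕ; zero; suc; _+_; _*_; _∸_; _≤_; _<_; s≤s; z≤n; parity; ∣_-_∣)
open import Data.Nat.Properties
  using ( ≤-trans; ≤-pred; <⇒≱; m≤m+n; m≤n+m; +-mono-≤; +-suc; suc-injective; *-comm; *-identityʳ
        ; ∣-∣-comm; ∣n-n∣≡0; ∣m-m+n∣≡n; ∣m+n-m+o∣≡∣n-o∣)
open import Data.Parity.Base using (0ℙ; 1ℙ; _⁻¹) renaming (_+_ to _+ᵖ_; _*_ to _*ᵖ_)
open import Data.Parity.Properties
  using (suc-homo-⁻¹) renaming (+-homo-+ to parity-+; *-homo-* to parity-*)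
open import Data.Product.Base using (_×_; _,_; ∃-syntax; ∃₂)
open import Data.Refinement.Base using (value; _,_)
open import Data.Refinement.Properties using (value-injective)
open import Data.Sum.Base using (_⊎_; inj₁; inj₂)
open import Data.Vec.Base using (Vec; []; _∷_)
open import Data.Vec.Properties using (∷-injective; ∷-injectiveʳ; ≡-dec)
open import Function.Base using (id; flip; _∘_)
open import Level using (0ℓ)
open import Relation.Binary.Construct.Closure.ReflexiveTransitive using (Star; ε; _◅_; _◅◅_; gmap)
open import Relation.Binary.Core using (Rel)
open import Relation.Binary.Definitions using (Symmetric)
open import Relation.Binary.PropositionalEquality
  using (_≡_; refl; sym; cong; cong₂; subst; setoid; module ≡-Reasoning)
  renaming (trans to ≡-trans)
open import Relation.Nullary.Decidable using (recompute)
open import Relation.Nullary.Negation using (contradiction)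

private
  variable
    A B C : Set
    R S T : Rel A 0ℓ
    x y z : A
    xs ys : List A

-- Parities

1≤even⇒2≤ : ∀ {m} → parity m ≡ 0ℙ → 1 ≤ m → 2 ≤ m
1≤even⇒2≤ {suc (suc m)} _ _ = s≤s (s≤s z≤n)

odd-pred : ∀ m → parity (suc m) ≡ 1ℙ → parity m ≡ 0ℙ
odd-pred m odd = ≡-trans (sym (suc-homo-⁻¹ m)) (cong _⁻¹ odd)

-- Two steps of the recurrence `u (n + 2) = u (n + 1) + u n` modulo 2, with `p = u (n + 1)` and
-- `q = u n`, give `u (n + 3) = u n`: hence the period three.
p+q+p≡q : ∀ p q → (p +ᵖ q) +ᵖ p ≡ q
p+q+p≡q 0ℙ 0ℙ = refl
p+q+p≡q 0ℙ 1ℙ = refl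
p+q+p≡q 1ℙ 0ℙ = refl
p+q+p≡q 1ℙ 1ℙ = refl

-- Permutations of grids

grid : (A → B → C) → List A → List B → List C
grid = cartesianProductWith

length-grid : ∀ (f : A → B → C) xs ys → length (grid f xs ys) ≡ length xs * length ys
length-grid f []       ys = refl
length-grid f (x ∷ xs) ys = ≡-trans (length-++ (map (f x) ys))
  (cong₂ _+_ (length-map (f x) ys) (length-grid f xs ys))

map-grid : ∀ {D : Set} (g : C → D) (f : A → B → C) xs ys →
  map g (grid f xs ys) ≡ grid (λ x y → g (f x y)) xs ys
map-grid g f []       ys = refl
map-grid g f (x ∷ xs) ys = ≡-trans (map-++ g (map (f x) ys) _)
  (cong₂ _++_ (sym (map-∘ ys)) (map-grid g f xs ys))

grid-congˡ : ∀ (f : A → B → C) ys {xs xs′} → xs ↭ xs′ → grid f xs ys ↭ grid f xs′ ys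
grid-congˡ f ys refl          = refl
grid-congˡ f ys (prep x p)    = ++⁺ˡ (map (f x) ys) (grid-congˡ f ys p)
grid-congˡ f ys (swap x x′ p) = ↭-trans (shifts (map (f x) ys) (map (f x′) ys))
  (++⁺ˡ (map (f x′) ys) (++⁺ˡ (map (f x) ys) (grid-congˡ f ys p)))
grid-congˡ f ys (trans p q)   = ↭-trans (grid-congˡ f ys p) (grid-congˡ f ys q)

grid-congʳ : ∀ (f : A → B → C) xs {ys ys′} → ys ↭ ys′ → grid f xs ys ↭ grid f xs ys′
grid-congʳ f []       p = refl
grid-congʳ f (x ∷ xs) p = ++⁺ (↭-map⁺ (f x) p) (grid-congʳ f xs p)

-- The grid is listed row by row, so splitting off a column takes a permutation. The cycle uses this
-- where one column is traversed apart from the rest of its grid.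
grid-consʳ : ∀ (f : A → B → C) xs y ys →
  grid f xs (y ∷ ys) ↭ map (flip f y) xs ++ grid f xs ys
grid-consʳ f []       y ys = refl
grid-consʳ f (x ∷ xs) y ys = prep _ (↭-trans
  (++⁺ˡ (map (f x) ys) (grid-consʳ f xs y ys))
  (shifts (map (f x) ys) (map (flip f y) xs)))

grid-flip : ∀ (f : A → B → C) xs ys → grid (flip f) ys xs ↭ grid f xs ys
grid-flip f []       []       = refl
grid-flip f (x ∷ xs) []       = grid-flip f xs []
grid-flip f xs       (y ∷ ys) = ↭-trans
  (++⁺ˡ (map (flip f y) xs) (grid-flip f xs ys)) (↭-sym (grid-consʳ f xs y ys))

-- Paths

tail : {x y : A} → Star R x y → List A
tail ε                  = []
tail (_◅_ {j = y} _ w)  = y ∷ tail w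

vertices : {x y : A} → Star R x y → List A
vertices {x = x} w = x ∷ tail w

tail-◅◅ : (w : Star R x y) (r : R y z) {u : A} (w′ : Star R z u) →
  tail (w ◅◅ r ◅ w′) ≡ tail w ++ vertices w′
tail-◅◅ ε       r w′ = refl
tail-◅◅ (_ ◅ w) r w′ = cong (_ ∷_) (tail-◅◅ w r w′)

tail-gmap : (f : A → B) (f-hom : ∀ {x y} → R x y → S (f x) (f y)) (w : Star R x y) →
  tail {R = S} (gmap f f-hom w) ≡ map f (tail w)
tail-gmap f f-hom ε       = refl
tail-gmap f f-hom (_ ◅ w) = cong (_ ∷_) (tail-gmap f f-hom w)

-- The vertices matter only up to order, so that paths can be compared with `words n`, for which
-- completeness and absence of repetitions are settled once.
record Path {A : Set} (R : Rel A 0ℓ) (x y : A) (xs : List A) : Set where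
  constructor path
  field
    walk   : Star R x y
    covers : vertices walk ↭ xs
open Path

⟨_⟩ : (w : Star R x y) → Path R x y (vertices w)
⟨ w ⟩ = path w refl

reorder : xs ↭ ys → Path R x y xs → Path R x y ys
reorder p (path w c) = path w (↭-trans c p)

infixr 5 _▸⟨_⟩_
_▸⟨_⟩_ : ∀ {u : A} → Path R x y xs → R y z → Path R z u ys → Path R x u (xs ++ ys)
path w c ▸⟨ r ⟩ path w′ c′ = path (w ◅◅ r ◅ w′)
  (↭-trans (↭-reflexive (cong (_ ∷_) (tail-◅◅ w r w′))) (++⁺ c c′))

mapPath : (f : A → B) (f-hom : ∀ {x y} → R x y → S (f x) (f y)) →
  Path R x y xs → Path S (f x) (f y) (map f xs)
mapPath f f-hom (path w c) = path (gmap f f-hom w)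
  (↭-trans (↭-reflexive (cong (_ ∷_) (tail-gmap f f-hom w))) (↭-map⁺ f c))

module _ {R : Rel A 0ℓ} (R-sym : Symmetric R) where

  reverseStar : (w : Star R x y) → Path R y x (vertices w)
  reverseStar ε       = ⟨ ε ⟩
  reverseStar (r ◅ w) = reorder (++-comm (vertices w) _)
    (reverseStar w ▸⟨ R-sym r ⟩ ⟨ ε ⟩)

  reverse : Path R x y xs → Path R y x xs
  reverse (path w c) = reorder c (reverseStar w)

uncons : Path R x y xs → 2 ≤ length xs →
  ∃₂ λ x′ xs′ → R x x′ × Path R x′ y xs′ × xs ↭ x ∷ xs′
uncons (path ε c)       long with s≤s () ← subst (2 ≤_) (sym (↭-length c)) long
uncons (path (r ◅ w) c) long = _ , _ , r , ⟨ w ⟩ , ↭-sym c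

-- Snakes

-- The column in which a snake ends if its row over the start of `w` runs from `u` to `v`: each
-- further row is traversed in the opposite direction, which exchanges `u` and `v`.
turn : {A B : Set} {R : Rel A 0ℓ} {x y : A} → Star R x y → B → B → B
turn ε       u v = v
turn (_ ◅ w) u v = turn w v u

turn-odd : ∀ {u v : B} (w : Star R x y) → parity (length (vertices w)) ≡ 1ℙ → turn w u v ≡ v
turn-odd ε           _   = refl
turn-odd (_ ◅ _ ◅ w) odd = turn-odd w odd

turn-even : ∀ {u v : B} (w : Star R x y) → parity (length (vertices w)) ≡ 0ℙ → turn w u v ≡ u
turn-even (_ ◅ ε)     _    = refl
turn-even (_ ◅ _ ◅ w) even = turn-even w even

module Snake {A B C : Set} {R : Rel A 0ℓ} {S : Rel B 0ℓ} {T : Rel C 0ℓ} (S-sym : Symmetric S)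
  (f : A → B → C)
  (f-homˡ : ∀ {a a′ b} → R a a′ → T (f a b) (f a′ b))
  (f-homʳ : ∀ {a b b′} → S b b′ → T (f a b) (f a b′))
  where

  -- Only the end of the first row matters, so that it may be replaced by any other path.
  snakeAfter : ∀ {a a′ b b′ c us vs} (w : Star R a a′) →
    Path T c (f a b′) us → Path S b b′ vs →
    Path T c (f a′ (turn w b b′)) (us ++ grid f (tail w) vs)
  snakeAfter {us = us} ε p row = reorder (↭-sym (↭-++-identityʳ us)) p
  snakeAfter {us = us} {vs} (r ◅ w) p row = reorder (↭-++-assoc us (map (f _) vs) _)
    (snakeAfter w (p ▸⟨ f-homˡ r ⟩ mapPath (f _) f-homʳ (reverse S-sym row)) (reverse S-sym row))

  module _ {a a′ b b′ c us vs} (w : Star R a a′) (p : Path T c (f a b′) us) (row : Path S b b′ vs) where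

    snakeAfterOdd : parity (length (vertices w)) ≡ 1ℙ →
      Path T c (f a′ b′) (us ++ grid f (tail w) vs)
    snakeAfterOdd odd = subst (λ v → Path T c (f a′ v) (us ++ grid f (tail w) vs))
      (turn-odd w odd) (snakeAfter w p row)

    snakeAfterEven : parity (length (vertices w)) ≡ 0ℙ →
      Path T c (f a′ b) (us ++ grid f (tail w) vs)
    snakeAfterEven even = subst (λ v → Path T c (f a′ v) (us ++ grid f (tail w) vs))
      (turn-even w even) (snakeAfter w p row)

  module _ {a a′ b b′ us vs} (col : Path R a a′ us) (row : Path S b b′ vs) where

    snakeOdd : parity (length us) ≡ 1ℙ → Path T (f a b) (f a′ b′) (grid f us vs)
    snakeOdd odd = reorder (grid-congˡ f vs (covers col))
      (snakeAfterOdd (walk col) (mapPath (f a) f-homʳ row) row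
        (≡-trans (cong parity (↭-length (covers col))) odd))

    snakeEven : parity (length us) ≡ 0ℙ → Path T (f a b) (f a′ b) (grid f us vs)
    snakeEven even = reorder (grid-congˡ f vs (covers col))
      (snakeAfterEven (walk col) (mapPath (f a) f-homʳ row) row
        (≡-trans (cong parity (↭-length (covers col))) even))

-- The cycle on abstract letters

private
  variable
    L : Set
    n : ℕ

-- An inductive form of distance 1 in which `here` and `there` serve directly as the row and column
-- steps of a snake.
data Step {L : Set} (_∼_ : Rel L 0ℓ) : ∀ {n} → Rel (Vec L n) 0ℓ where
  here  : ∀ {n c d} {x : Vec L n} → c ∼ d → Step _∼_ (c ∷ x) (d ∷ x)
  there : ∀ {n c} {x y : Vec L n} → Step _∼_ x y → Step _∼_ (c ∷ x) (c ∷ y)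

Step-sym : {_∼_ : Rel L 0ℓ} → Symmetric _∼_ → Symmetric (Step _∼_ {n})
Step-sym ∼-sym (here c∼d)  = here (∼-sym c∼d)
Step-sym ∼-sym (there x~y) = there (Step-sym ∼-sym x~y)

-- The low letters form a path from o = 0 to e = a - 1, the high letters a path from
-- f = a to g = a + b - 1.
module Construction
  {L : Set} {_∼_ : Rel L 0ℓ} (∼-sym : Symmetric _∼_)
  {o e f g : L} (lows : Star _∼_ o e) (e∼f : e ∼ f) (highs : Star _∼_ f g)
  (lows-odd  : parity (length (vertices lows))  ≡ 1ℙ)
  (highs-odd : parity (length (vertices highs)) ≡ 1ℙ)
  where

  _~_ : Rel (Vec L n) 0ℓ
  _~_ = Step _∼_

  ~-sym : Symmetric (_~_ {n})
  ~-sym = Step-sym ∼-sym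

  -- The Hamiltonian path

  lows↓ : Path _∼_ e o (vertices lows)
  lows↓ = reverseStar ∼-sym lows

  LT HS : List L
  LT = tail (walk lows↓)
  HS = vertices highs

  -- The summand map (e ∷_) (words n) is split off because the cycle runs through it
  -- differently than the Hamiltonian path does.
  words  : ∀ n → List (Vec L n)
  words′ : ∀ n → List (Vec L (suc n))
  words zero     = [ [] ]
  words (suc n)  = map (e ∷_) (words n) ++ words′ n
  words′ zero    = grid _∷_ LT (words zero)
  words′ (suc n) = grid _∷_ LT (words (suc n)) ++ map (o ∷_) (grid _∷_ HS (words n))

  -- `source` descends by two because the path, taken from `target`, finishes in the copy of
  -- `words n` behind `o g`; length one has no such copy, and the snake stops at `o`.
  target source : ∀ n → Vec L n
  target zero           = []
  target (suc n)        = e ∷ source n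
  source zero           = []
  source (suc zero)     = o ∷ []
  source (suc (suc n))  = o ∷ g ∷ target n

  module Words {n} = Snake {R = _∼_} {S = _~_ {n}} {T = _~_} ~-sym _∷_ here there

  lows↓-odd : parity (length (vertices (walk lows↓))) ≡ 1ℙ
  lows↓-odd = ≡-trans (cong parity (↭-length (covers lows↓))) lows-odd

  -- The path `p` stands in for the layer `e`. The odd number of low layers brings the snake to
  -- `o ∷ target n`; for positive `n` this begins with `o e`, and `e∼f` leads into the high copies.
  complete : ∀ n {x us} → Path _~_ x (e ∷ target n) us → Path _~_ x (source (suc n)) (us ++ words′ n)
  hamPath  : ∀ n → Path _~_ (source n) (target n) (words n)
  complete zero    p = Words.snakeAfterOdd (walk lows↓) p (hamPath zero) lows↓-odd
  complete (suc n) {us = us} p = reorder (↭-++-assoc us _ _)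
    (Words.snakeAfterOdd (walk lows↓) p (hamPath (suc n)) lows↓-odd
      ▸⟨ there (here e∼f) ⟩
    mapPath (o ∷_) there (Words.snakeOdd ⟨ highs ⟩ (hamPath n) highs-odd))
  hamPath zero    = ⟨ ε ⟩
  hamPath (suc n) = reverse ~-sym (complete n (mapPath (e ∷_) there (hamPath n)))

  -- The number of words

  length-words-suc : ∀ n → length (words (suc n)) ≡ length (words n) + length (words′ n)
  length-words-suc n = ≡-trans (length-++ (map (e ∷_) (words n)))
    (cong (_+ length (words′ n)) (length-map (e ∷_) (words n)))

  length-words′ : ∀ n → length (words′ (suc n)) ≡
    length LT * length (words (suc n)) + length HS * length (words n)
  length-words′ n = ≡-trans (length-++ (grid _∷_ LT (words (suc n)))) (cong₂ _+_
    (length-grid _∷_ LT (words (suc n)))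
    (≡-trans (length-map (o ∷_) (grid _∷_ HS (words n))) (length-grid _∷_ HS (words n))))

  length-words-mono : ∀ n → length (words n) ≤ length (words (suc n))
  length-words-mono n = subst (length (words n) ≤_) (sym (length-words-suc n)) (m≤m+n _ _)

  1≤words : ∀ n → 1 ≤ length (words n)
  1≤words zero    = s≤s z≤n
  1≤words (suc n) = ≤-trans (1≤words n) (length-words-mono n)

  1≤words′ : ∀ n → 1 ≤ length (words′ (suc n))
  1≤words′ n = subst (1 ≤_) (sym (length-words′ n))
    (≤-trans (1≤words n) (≤-trans (m≤m+n _ _)
      (m≤n+m (length HS * length (words n)) (length LT * length (words (suc n))))))

  -- Leaves two vertices when the first one is removed from a Hamiltonian path, so that the last
  -- edge survives for the detour in `lowLayers`; it also makes the cycle long enough.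
  3≤words : ∀ n → parity (length (words (suc n))) ≡ 0ℙ → 3 ≤ length (words (suc (suc n)))
  3≤words n even = subst (3 ≤_) (sym (length-words-suc (suc n)))
    (+-mono-≤ (1≤even⇒2≤ even (1≤words (suc n))) (1≤words′ n))

  UP : List L
  UP = tail lows

  words-one : words 1 ↭ grid _∷_ (vertices lows) (words 0)
  words-one = grid-congˡ _∷_ (words 0) (covers lows↓)

  words-suc-suc : ∀ n → words (suc (suc n)) ↭
    grid _∷_ (vertices lows) (words (suc n)) ++ map (o ∷_) (grid _∷_ HS (words n))
  words-suc-suc n = ↭-trans (↭-sym (↭-++-assoc (map (e ∷_) (words (suc n))) _ _))
    (++⁺ʳ _ (grid-congˡ _∷_ (words (suc n)) (covers lows↓)))

  LT-even : parity (length LT) ≡ 0ℙ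
  LT-even = odd-pred (length LT) lows↓-odd

  parity-words : ∀ n → parity (length (words (suc (suc n)))) ≡
    parity (length (words (suc n))) +ᵖ parity (length (words n))
  parity-words n = begin
    parity (length (words (suc (suc n))))  ≡⟨ cong parity (length-words-suc (suc n)) ⟩
    parity (w + length (words′ (suc n)))   ≡⟨ parity-+ w _ ⟩
    parity w +ᵖ parity (length (words′ (suc n)))
      ≡⟨ cong (λ m → parity w +ᵖ parity m) (length-words′ n) ⟩
    parity w +ᵖ parity (length LT * w + length HS * v)
      ≡⟨ cong (parity w +ᵖ_) (parity-+ (length LT * w) _) ⟩
    parity w +ᵖ (parity (length LT * w) +ᵖ parity (length HS * v))
      ≡⟨ cong (parity w +ᵖ_) (cong₂ _+ᵖ_ (parity-* (length LT) w) (parity-* (length HS) v)) ⟩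
    parity w +ᵖ ((parity (length LT) *ᵖ parity w) +ᵖ (parity (length HS) *ᵖ parity v))
      ≡⟨ cong (parity w +ᵖ_) (cong₂ (λ l h → (l *ᵖ parity w) +ᵖ (h *ᵖ parity v)) LT-even highs-odd) ⟩
    parity w +ᵖ parity v ∎
    where
    open ≡-Reasoning
    w = length (words (suc n))
    v = length (words n)

  words-even : ∀ j → parity (length (words (2 + j * 3))) ≡ 0ℙ
  words-even zero    = ≡-trans (parity-words 0) (cong (_+ᵖ 1ℙ) (begin
    parity (suc (length (grid _∷_ LT (words 0))))  ≡⟨ cong (parity ∘ suc) (length-grid _∷_ LT (words 0)) ⟩
    parity (suc (length LT * 1))                   ≡⟨ cong (parity ∘ suc) (*-identityʳ (length LT)) ⟩
    parity (suc (length LT))                       ≡⟨ lows↓-odd ⟩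
    1ℙ                                             ∎))
    where open ≡-Reasoning
  words-even (suc j) = begin
    parity (length (words (5 + j * 3)))                    ≡⟨ parity-words (3 + j * 3) ⟩
    parity (length (words (4 + j * 3))) +ᵖ p               ≡⟨ cong (_+ᵖ p) (parity-words (2 + j * 3)) ⟩
    (p +ᵖ parity (length (words (2 + j * 3)))) +ᵖ p        ≡⟨ p+q+p≡q p _ ⟩
    parity (length (words (2 + j * 3)))                    ≡⟨ words-even j ⟩
    0ℙ                                                     ∎
    where
    open ≡-Reasoning
    p = parity (length (words (3 + j * 3)))

  -- The Hamiltonian cycle

  module Layers {n} = Snake {R = _∼_} {S = _~_ {n}} {T = _~_} ~-sym
    (λ c x → o ∷ c ∷ x) (there ∘ here) (there ∘ there)

  -- The roles are interchanged: a row of this snake is a run of letters before a fixed word, and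
  -- the rows succeed each other along a path of words.
  module Columns {n} = Snake {R = _~_ {n}} {S = _∼_} {T = _~_} ∼-sym (flip _∷_) there here

  -- The columns f x, ..., g x over consecutive vertices x of the path are joined in pairs into
  -- detours from the row e x, which is why the number of vertices has to be even.
  zipped : ∀ n → parity (length (words n)) ≡ 0ℙ →
    Path _~_ (target (suc n)) (source (suc n)) (words (suc n) ++ grid _∷_ HS (words n))
  zipped n even = reorder eq
    (complete n (Columns.snakeEven (hamPath n) ⟨ e∼f ◅ highs ⟩ even))
    where
    open PermutationReasoning
    eq = begin
      grid (flip _∷_) (words n) (e ∷ HS) ++ words′ n
        ↭⟨ ++⁺ʳ (words′ n) (grid-flip _∷_ (e ∷ HS) (words n)) ⟩
      (map (e ∷_) (words n) ++ grid _∷_ HS (words n)) ++ words′ n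
        ↭⟨ ↭-++-assoc (map (e ∷_) (words n)) _ _ ⟩
      map (e ∷_) (words n) ++ grid _∷_ HS (words n) ++ words′ n
        ↭⟨ ++⁺ˡ (map (e ∷_) (words n)) (++-comm (grid _∷_ HS (words n)) (words′ n)) ⟩
      map (e ∷_) (words n) ++ words′ n ++ grid _∷_ HS (words n)
        ↭⟨ ↭-++-assoc (map (e ∷_) (words n)) _ _ ⟨
      words (suc n) ++ grid _∷_ HS (words n) ∎

  -- ps is the Hamiltonian path of words (suc n) without its first vertex.
  module _ {n} {p : Vec L (suc n)} {PS : List (Vec L (suc n))}
    (ps : Path _~_ p (source (suc n)) PS) (p~ : target (suc n) ~ p)
    (PS-covers : words (suc n) ↭ target (suc n) ∷ PS) (PS-long : 2 ≤ length PS)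
    where

    Y = source (suc n)

    -- The stretch of the cycle through the copies `o c` with `c` low, including the detour through
    -- the other low layers. `up` is a parameter so that it can be split into cases: for `ε` the
    -- letters `o` and `e` coincide, and the copy of `o` is also the last low one. Otherwise the
    -- remaining copies are even in number, and the snake enters and leaves them in the column `Y`.
    lowLayers : (up : Star _∼_ o e) → parity (length (vertices up)) ≡ 1ℙ → ∀ {us} →
      Path _~_ (o ∷ target (suc n)) (o ∷ Y) us →
      Path _~_ (o ∷ o ∷ target (suc n)) (o ∷ e ∷ Y)
        (map (o ∷_) us ++ map (o ∷_) (grid _∷_ (tail up) PS)
          ++ grid _∷_ (tail up) (words (suc (suc n))))
    lowLayers ε         odd z = reorder (↭-sym (↭-++-identityʳ _)) (mapPath (o ∷_) there z)
    lowLayers (_◅_ {j = c₁} o∼c₁ up) odd z with uncons (reverse ~-sym ps) PS-long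
    ... | s′ , WS , Y~s′ , w , PS↭ =
      mapPath (o ∷_) there z ▸⟨ there (here o∼c₁) ⟩ reverse ~-sym (reorder eq detour)
      where
      open PermutationReasoning
      up-even : parity (length (vertices up)) ≡ 0ℙ
      up-even = odd-pred (length (vertices up)) odd

      down : Path _∼_ e c₁ (vertices up)
      down = reverseStar ∼-sym up

      QS : List (Vec L (suc (suc n)))
      QS = map (e ∷_) (WS ++ [ target (suc n) ]) ++ words′ (suc n)

      -- Preceded by e Y, this is a Hamiltonian path; the copies of it on the letters of up replace
      -- the edge between o e Y and o e s′.
      qs : Path _~_ (e ∷ s′) (source (suc (suc n))) QS
      qs = complete (suc n) (mapPath (e ∷_) there (w ▸⟨ ~-sym p~ ⟩ ⟨ ε ⟩))

      QS-covers : words (suc (suc n)) ↭ (e ∷ Y) ∷ QS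
      QS-covers = ++⁺ʳ (words′ (suc n)) (↭-map⁺ (e ∷_) (begin
        words (suc n)                   ↭⟨ PS-covers ⟩
        target (suc n) ∷ PS             ↭⟨ prep _ PS↭ ⟩
        target (suc n) ∷ (Y ∷ WS)       ↭⟨ ++-comm [ target (suc n) ] (Y ∷ WS) ⟩
        (Y ∷ WS) ++ [ target (suc n) ]  ∎))

      column : Path _~_ (c₁ ∷ e ∷ Y) (e ∷ e ∷ Y) (map (_∷ e ∷ Y) (vertices up))
      column = mapPath (_∷ e ∷ Y) here ⟨ up ⟩

      -- From `o e Y` the path climbs the column `e Y` to the layer `e`, sweeps the rest of the
      -- layers, an even number, back down to `c₁ e s′`, and returns to the row at `o e s′`.
      top : Path _~_ (o ∷ e ∷ Y) (o ∷ e ∷ p)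
        ([ o ∷ e ∷ Y ] ++ map (_∷ e ∷ Y) (vertices up) ++ grid _∷_ (vertices up) QS
          ++ map (λ x → o ∷ e ∷ x) WS)
      top = ⟨ ε ⟩ ▸⟨ here o∼c₁ ⟩ column ▸⟨ there (there Y~s′) ⟩
        Words.snakeEven down qs up-even ▸⟨ here (∼-sym o∼c₁) ⟩
        mapPath (λ x → o ∷ e ∷ x) (there ∘ there) w

      -- `top` is the modified row `o e`. Only the first row of a snake can be replaced, so the
      -- snake is built from `e` down to `c₁` and reversed afterwards.
      detour = Layers.snakeAfterEven (walk down) top (reverse ~-sym ps)
        (≡-trans (cong parity (↭-length (covers down))) up-even)

      open CommutativeMonoidSolver (++-commutativeMonoid {A = Vec L (3 + n)})
        using (solve; _⊜_; _⊕_)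

      eq = begin
        ([ o ∷ e ∷ Y ] ++ map (_∷ e ∷ Y) (vertices up) ++ grid _∷_ (vertices up) QS
          ++ map (λ x → o ∷ e ∷ x) WS) ++ grid (λ c x → o ∷ c ∷ x) (tail (walk down)) PS
          ↭⟨ solve 5 (λ y u q w r → (y ⊕ u ⊕ q ⊕ w) ⊕ r ⊜ ((y ⊕ w) ⊕ r) ⊕ (u ⊕ q)) refl
               [ o ∷ e ∷ Y ] (map (_∷ e ∷ Y) (vertices up)) (grid _∷_ (vertices up) QS)
               (map (λ x → o ∷ e ∷ x) WS) (grid (λ c x → o ∷ c ∷ x) (tail (walk down)) PS) ⟩
        (map (λ x → o ∷ e ∷ x) (Y ∷ WS) ++ grid (λ c x → o ∷ c ∷ x) (tail (walk down)) PS)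
          ++ (map (_∷ e ∷ Y) (vertices up) ++ grid _∷_ (vertices up) QS)
          ↭⟨ ++⁺ (++⁺ʳ _ (↭-map⁺ (λ x → o ∷ e ∷ x) PS↭)) (grid-consʳ _∷_ (vertices up) (e ∷ Y) QS) ⟨
        grid (λ c x → o ∷ c ∷ x) (vertices (walk down)) PS
          ++ grid _∷_ (vertices up) ((e ∷ Y) ∷ QS)
          ↭⟨ ++⁺ (grid-congˡ _ PS (covers down)) (grid-congʳ _∷_ (vertices up) (↭-sym QS-covers)) ⟩
        grid (λ c x → o ∷ c ∷ x) (vertices up) PS
          ++ grid _∷_ (vertices up) (words (suc (suc n)))
          ≡⟨ cong (_++ grid _∷_ (vertices up) (words (suc (suc n))))
               (map-grid (o ∷_) _∷_ (vertices up) PS) ⟨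
        map (o ∷_) (grid _∷_ (vertices up) PS)
          ++ grid _∷_ (vertices up) (words (suc (suc n))) ∎

    -- The return column must stop next to `o`, at the second low letter or, if `o` is the only one,
    -- at `f`.
    afterZero : (w : Star _∼_ o e) → ∃[ c ] o ∼ c × Path _∼_ c g (tail w ++ HS)
    afterZero ε         = f , e∼f , ⟨ highs ⟩
    afterZero (o∼c ◅ w) = _ , o∼c , ⟨ w ⟩ ▸⟨ e∼f ⟩ ⟨ highs ⟩

    closedPath : parity (length (words n)) ≡ 0ℙ →
      ∃[ z ] z ~ (o ∷ o ∷ target (suc n)) × Path _~_ (o ∷ o ∷ target (suc n)) z (words (3 + n))
    closedPath even with afterZero lows
    ... | c , o∼c , column = o ∷ c ∷ F , there (here (∼-sym o∼c)) , reorder eq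
      (lowLayers lows lows-odd (mapPath (o ∷_) there (zipped n even)) ▸⟨ there (here e∼f) ⟩
       -- The high copies are odd in number, so this snake goes from `Y` to `p` and ends next to the
       -- column `F` that was left free.
       mapPath (o ∷_) there (Words.snakeOdd ⟨ highs ⟩ (reverse ~-sym ps) highs-odd)
         ▸⟨ there (there (~-sym p~)) ⟩
       mapPath (λ c → o ∷ c ∷ F) (there ∘ here) (reverse ∼-sym column))
      where
      open PermutationReasoning
      F = target (suc n)
      W₀ = words n
      W₁ = words (suc n)
      W₂ = words (suc (suc n))
      Z  = map (o ∷_) (W₁ ++ grid _∷_ HS W₀)

      module Inner = CommutativeMonoidSolver (++-commutativeMonoid {A = Vec L (2 + n)})
      module Outer = CommutativeMonoidSolver (++-commutativeMonoid {A = Vec L (3 + n)})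

      split : ∀ cs → map (_∷ F) cs ++ grid _∷_ cs PS ↭ grid _∷_ cs W₁
      split cs = ↭-trans (↭-sym (grid-consʳ _∷_ cs F PS)) (grid-congʳ _∷_ cs (↭-sym PS-covers))

      -- What follows a first letter `o`. The return column fills up the copies snaked without `F`:
      -- the low ones join `Z` to form `W₂`, the high ones form `grid _∷_ HS W₁`.
      inner = begin
        Z ++ grid _∷_ UP PS ++ grid _∷_ HS PS ++ map (_∷ F) (UP ++ HS)
          ≡⟨ cong₂ (λ z u → z ++ grid _∷_ UP PS ++ grid _∷_ HS PS ++ u)
               (map-++ (o ∷_) W₁ (grid _∷_ HS W₀)) (map-++ (_∷ F) UP HS) ⟩
        (map (o ∷_) W₁ ++ map (o ∷_) (grid _∷_ HS W₀)) ++ grid _∷_ UP PS ++ grid _∷_ HS PS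
          ++ map (_∷ F) UP ++ map (_∷ F) HS
          ↭⟨ Inner.solve 6 (λ w v u′ h′ u h →
               ((w ⊕ v) ⊕ (u′ ⊕ (h′ ⊕ (u ⊕ h)))) Inner.⊜ (((w ⊕ (u ⊕ u′)) ⊕ v) ⊕ (h ⊕ h′))) refl
               (map (o ∷_) W₁) (map (o ∷_) (grid _∷_ HS W₀)) (grid _∷_ UP PS) (grid _∷_ HS PS)
               (map (_∷ F) UP) (map (_∷ F) HS) ⟩
        ((map (o ∷_) W₁ ++ map (_∷ F) UP ++ grid _∷_ UP PS) ++ map (o ∷_) (grid _∷_ HS W₀))
          ++ map (_∷ F) HS ++ grid _∷_ HS PS
          ↭⟨ ++⁺ (++⁺ʳ (map (o ∷_) (grid _∷_ HS W₀)) (++⁺ˡ (map (o ∷_) W₁) (split UP))) (split HS) ⟩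
        (grid _∷_ (vertices lows) W₁ ++ map (o ∷_) (grid _∷_ HS W₀)) ++ grid _∷_ HS W₁
          ↭⟨ ++⁺ʳ (grid _∷_ HS W₁) (words-suc-suc n) ⟨
        W₂ ++ grid _∷_ HS W₁ ∎
        where open Inner using (_⊕_)

      eq = begin
        (map (o ∷_) Z ++ map (o ∷_) (grid _∷_ UP PS) ++ grid _∷_ UP W₂)
          ++ map (o ∷_) (grid _∷_ HS PS) ++ map (λ c → o ∷ c ∷ F) (UP ++ HS)
          ↭⟨ Outer.solve 5 (λ z u w h k →
               ((z ⊕ (u ⊕ w)) ⊕ (h ⊕ k)) Outer.⊜ ((z ⊕ (u ⊕ (h ⊕ k))) ⊕ w)) refl
               (map (o ∷_) Z) (map (o ∷_) (grid _∷_ UP PS)) (grid _∷_ UP W₂)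
               (map (o ∷_) (grid _∷_ HS PS)) (map (λ c → o ∷ c ∷ F) (UP ++ HS)) ⟩
        (map (o ∷_) Z ++ map (o ∷_) (grid _∷_ UP PS) ++ map (o ∷_) (grid _∷_ HS PS)
          ++ map (λ c → o ∷ c ∷ F) (UP ++ HS)) ++ grid _∷_ UP W₂
          ≡⟨ cong (_++ grid _∷_ UP W₂) (sym map-++³) ⟩
        map (o ∷_) (Z ++ grid _∷_ UP PS ++ grid _∷_ HS PS ++ map (_∷ F) (UP ++ HS)) ++ grid _∷_ UP W₂
          ↭⟨ ++⁺ʳ (grid _∷_ UP W₂) (↭-map⁺ (o ∷_) inner) ⟩
        map (o ∷_) (W₂ ++ grid _∷_ HS W₁) ++ grid _∷_ UP W₂
          ≡⟨ cong (_++ grid _∷_ UP W₂) (map-++ (o ∷_) W₂ (grid _∷_ HS W₁)) ⟩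
        (map (o ∷_) W₂ ++ map (o ∷_) (grid _∷_ HS W₁)) ++ grid _∷_ UP W₂
          ↭⟨ Outer.solve 3 (λ w h u → ((w ⊕ h) ⊕ u) Outer.⊜ ((w ⊕ u) ⊕ h)) refl
               (map (o ∷_) W₂) (map (o ∷_) (grid _∷_ HS W₁)) (grid _∷_ UP W₂) ⟩
        grid _∷_ (vertices lows) W₂ ++ map (o ∷_) (grid _∷_ HS W₁)
          ↭⟨ words-suc-suc (suc n) ⟨
        words (3 + n) ∎
        where
        open Outer using (_⊕_)
        map-++³ : map (o ∷_) (Z ++ grid _∷_ UP PS ++ grid _∷_ HS PS ++ map (_∷ F) (UP ++ HS)) ≡
          map (o ∷_) Z ++ map (o ∷_) (grid _∷_ UP PS) ++ map (o ∷_) (grid _∷_ HS PS)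
            ++ map (λ c → o ∷ c ∷ F) (UP ++ HS)
        map-++³ = ≡-trans (map-++ (o ∷_) Z _) (cong (map (o ∷_) Z ++_)
          (≡-trans (map-++ (o ∷_) (grid _∷_ UP PS) _) (cong (map (o ∷_) (grid _∷_ UP PS) ++_)
          (≡-trans (map-++ (o ∷_) (grid _∷_ HS PS) _) (cong (map (o ∷_) (grid _∷_ HS PS) ++_)
          (sym (map-∘ (UP ++ HS))))))))

  -- The Hamiltonian path of `words (2 + n)` is taken from `target`, whose removal leaves the return
  -- column free; the evenness for `words (suc n)` is what `zipped` needs.
  cyclicPath : ∀ n → parity (length (words (suc n))) ≡ 0ℙ →
    ∃₂ λ x z → z ~ x × Path _~_ x z (words (4 + n))
  cyclicPath n even
    with uncons (reverse ~-sym (hamPath (suc (suc n)))) (≤-trans (s≤s (s≤s z≤n)) (3≤words n even))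
  ... | p , PS , p~ , ps , PS-covers = _ , closedPath ps p~ PS-covers
    (≤-pred (subst (3 ≤_) (↭-length PS-covers) (3≤words n even))) even

-- Letters as elements of Fin (a + b)

Near : ∀ {k} → Rel (Fin k) 0ℓ
Near c d = ∣ toℕ c - toℕ d ∣ ≡ 1

Near-sym : ∀ {k} {c d : Fin k} → Near c d → Near d c
Near-sym {c = c} {d} = ≡-trans (∣-∣-comm (toℕ d) (toℕ c))

line : ∀ k → Star (Near {suc k}) zero (fromℕ k)
line zero    = ε
line (suc k) = refl ◅ gmap suc id (line k)

tail-line : ∀ k → tail (line k) ≡ tabulate suc
tail-line zero    = refl
tail-line (suc k) = cong (suc zero ∷_) (begin
  tail (gmap {U = Near} suc id (line k))       ≡⟨ tail-gmap suc id (line k) ⟩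
  map suc (tail (line k))                      ≡⟨ cong (map suc) (tail-line k) ⟩
  map suc (tabulate suc)                       ≡⟨ map-tabulate suc suc ⟩
  tabulate (λ i → suc (suc i))                 ∎)
  where open ≡-Reasoning

Linked-vertices : ∀ {A : Set} {R : Rel A 0ℓ} {x y z} (w : Star R x y) → R y z →
  Linked R (vertices w ∷ʳ z)
Linked-vertices ε       y~z = y~z ∷ [-]
Linked-vertices (r ◅ w) y~z = r ∷ Linked-vertices w y~z

Step⇒distance : ∀ {k n} {x y : Vec (Fin k) n} → Step Near x y → distance x y ≡ 1
Step⇒distance (here {x = x} c~d)  = cong₂ _+_ c~d (distance-refl x)
Step⇒distance (there {c = c} x~y) = cong₂ _+_ (∣n-n∣≡0 (toℕ c)) (Step⇒distance x~y)

module Letters (a′ b′ : ℕ) (a-odd : parity (suc a′) ≡ 1ℙ) (b-odd : parity (suc b′) ≡ 1ℙ) where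

  a = suc a′
  b = suc b′

  lows : Star Near (zero ↑ˡ b) (fromℕ a′ ↑ˡ b)
  lows = gmap (_↑ˡ b) (λ {c} {d} c~d →
    ≡-trans (cong₂ ∣_-_∣ (toℕ-↑ˡ c b) (toℕ-↑ˡ d b)) c~d) (line a′)

  highs : Star Near (a ↑ʳ zero) (a ↑ʳ fromℕ b′)
  highs = gmap (a ↑ʳ_) (λ {c} {d} c~d →
    ≡-trans (cong₂ ∣_-_∣ (toℕ-↑ʳ a c) (toℕ-↑ʳ a d))
      (≡-trans (∣m+n-m+o∣≡∣n-o∣ a (toℕ c) (toℕ d)) c~d)) (line b′)

  vertices-lows : vertices lows ≡ map (_↑ˡ b) (allFin a)
  vertices-lows = cong ((zero ↑ˡ b) ∷_) (≡-trans (tail-gmap (_↑ˡ b) _ (line a′)) (cong (map (_↑ˡ b)) (tail-line a′)))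

  vertices-highs : vertices highs ≡ map (a ↑ʳ_) (allFin b)
  vertices-highs = cong ((a ↑ʳ zero) ∷_) (≡-trans (tail-gmap (a ↑ʳ_) _ (line b′)) (cong (map (a ↑ʳ_)) (tail-line b′)))

  low-high : Near (fromℕ a′ ↑ˡ b) (a ↑ʳ zero)
  low-high = begin
    ∣ toℕ (fromℕ a′ ↑ˡ b) - toℕ (a ↑ʳ zero {b′}) ∣
      ≡⟨ cong₂ ∣_-_∣ (≡-trans (toℕ-↑ˡ (fromℕ a′) b) (toℕ-fromℕ a′)) (toℕ-↑ʳ a (zero {b′})) ⟩
    ∣ a′ - suc (a′ + 0) ∣  ≡⟨ cong ∣ a′ -_∣ (+-suc a′ 0) ⟨
    ∣ a′ - a′ + 1 ∣        ≡⟨ ∣m-m+n∣≡n a′ 1 ⟩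
    1                      ∎
    where open ≡-Reasoning

  low : ∀ {c} → c ∈ vertices lows → toℕ c < a
  low {c} c∈ with i , _ , refl ← ∈-map⁻ (_↑ˡ b) (subst (c ∈_) vertices-lows c∈) =
    subst (_< a) (sym (toℕ-↑ˡ i b)) (toℕ<n i)

  high : ∀ {c} → c ∈ vertices highs → a ≤ toℕ c
  high {c} c∈ with i , _ , refl ← ∈-map⁻ (a ↑ʳ_) (subst (c ∈_) vertices-highs c∈) =
    subst (a ≤_) (sym (toℕ-↑ʳ a i)) (m≤m+n a (toℕ i))

  low⊎high : ∀ c → c ∈ vertices lows ⊎ c ∈ vertices highs
  low⊎high c with splitAt a c | join-splitAt a b c
  ... | inj₁ i | refl = inj₁ (subst (i ↑ˡ b ∈_) (sym vertices-lows) (∈-map⁺ (_↑ˡ b) (∈-allFin i)))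
  ... | inj₂ i | refl = inj₂ (subst (a ↑ʳ i ∈_) (sym vertices-highs) (∈-map⁺ (a ↑ʳ_) (∈-allFin i)))

  length-line : ∀ {k} {f : Fin k → Fin (a + b)} {xs} → xs ≡ map f (allFin k) → length xs ≡ k
  length-line {k} {f} refl = ≡-trans (length-map f (allFin k)) (length-tabulate {n = k} id)

  open Construction {_∼_ = Near} (λ {c} {d} → Near-sym {c = c} {d}) lows low-high highs
    (≡-trans (cong parity (length-line vertices-lows)) a-odd)
    (≡-trans (cong parity (length-line vertices-highs)) b-odd) public

  lows-unique : Unique (vertices lows)
  lows-unique = subst Unique (sym vertices-lows) (Unique.map⁺ (↑ˡ-injective b _ _) (Unique.allFin⁺ a))

  highs-unique : Unique (vertices highs)
  highs-unique = subst Unique (sym vertices-highs) (Unique.map⁺ (↑ʳ-injective a _ _) (Unique.allFin⁺ b))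

  -- Admissible words

  Adm : ∀ {n} → Word a b n → Set
  Adm = Admissible a b

  -- A high first letter would need a position before it.
  head-low : ∀ {n c} {x : Word a b n} → Adm (c ∷ x) → c ∈ vertices lows
  head-low {c = c} adm with low⊎high c
  ... | inj₁ l = l
  ... | inj₂ h with _ , () , _ ← adm zero (high h)

  Adm-low∷ : ∀ {n c} {x : Word a b n} → toℕ c < a → Adm x → Adm (c ∷ x)
  Adm-low∷ c<a adm zero    a≤c = contradiction a≤c (<⇒≱ c<a)
  Adm-low∷ c<a adm (suc i) a≤  with j , eq , z ← adm i a≤ = suc j , cong suc eq , z

  Adm-0∷ : ∀ {n d} {x : Word a b n} → Adm x → Adm (zero ∷ d ∷ x)
  Adm-0∷ adm (suc zero)    _  = zero , refl , refl
  Adm-0∷ adm (suc (suc i)) a≤ with j , eq , z ← adm i a≤ = suc (suc j) , cong (2 +_) eq , z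

  -- With `d` low, no remaining letter relies on the deleted `c`.
  Adm-low∷⁻ : ∀ {n c d} {x : Word a b n} → d ∈ vertices lows → Adm (c ∷ d ∷ x) → Adm (d ∷ x)
  Adm-low∷⁻ d∈ adm zero    a≤d = contradiction a≤d (<⇒≱ (low d∈))
  Adm-low∷⁻ d∈ adm (suc i) a≤  with adm (suc (suc i)) a≤
  ... | suc j , eq , z = j , suc-injective eq , z

  -- A high `d` is not 0, so it cannot justify a high letter after it; hence both letters can be
  -- removed together.
  Adm-high∷⁻ : ∀ {n c d} {x : Word a b n} → d ∈ vertices highs → Adm (c ∷ d ∷ x) → c ≡ zero × Adm x
  Adm-high∷⁻ {c = c} {d} {x} d∈ adm = c≡0 (adm (suc zero) (high d∈)) , tail-adm
    where
    c≡0 : _ → c ≡ zero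
    c≡0 (zero  , _  , z) = toℕ-injective z
    c≡0 (suc _ , () , _)
    tail-adm : Adm x
    tail-adm i a≤ with adm (suc (suc i)) a≤
    ... | suc zero    , _  , z = contradiction (high d∈) (<⇒≱ (subst (_< a) (sym z) (s≤s z≤n)))
    ... | suc (suc j) , eq , z = j , suc-injective (suc-injective eq) , z

  -- The second letter decides in which summand of `words-suc-suc` a word lies.
  complete-words : ∀ {n} (x : Word a b n) → Adm x → x ∈ words n
  complete-words []          adm = here refl
  complete-words (c ∷ [])    adm = ∈-resp-↭ (↭-sym words-one)
    (∈-cartesianProductWith⁺ _∷_ (head-low adm) (here refl))
  complete-words {suc (suc n)} (c ∷ d ∷ x) adm
    with low⊎high d | complete-words (d ∷ x) | complete-words x
  ... | inj₁ l | dx∈ | _ = ∈-resp-↭ (↭-sym (words-suc-suc n)) (∈-++⁺ˡ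
    (∈-cartesianProductWith⁺ _∷_ (head-low adm) (dx∈ (Adm-low∷⁻ l adm))))
  ... | inj₂ h | _ | x∈ with refl , adm′ ← Adm-high∷⁻ h adm = ∈-resp-↭ (↭-sym (words-suc-suc n))
    (∈-++⁺ʳ _ (∈-map⁺ (zero ∷_) (∈-cartesianProductWith⁺ _∷_ h (x∈ adm′))))

  sound-words : ∀ n {x} → x ∈ words n → Adm x
  sound-words zero x∈ ()
  sound-words (suc zero) x∈
    with c , y , c∈ , y∈ , refl ← ∈-cartesianProductWith⁻ _∷_ (vertices lows) (words 0)
      (∈-resp-↭ words-one x∈)
    = Adm-low∷ (low c∈) (sound-words 0 y∈)
  sound-words (suc (suc n)) x∈
    with ∈-++⁻ (grid _∷_ (vertices lows) (words (suc n))) (∈-resp-↭ (words-suc-suc n) x∈)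
  ... | inj₁ x∈ˡ
    with c , y , c∈ , y∈ , refl ← ∈-cartesianProductWith⁻ _∷_ (vertices lows) (words (suc n)) x∈ˡ
    = Adm-low∷ (low c∈) (sound-words (suc n) y∈)
  ... | inj₂ x∈ʳ
    with _ , z∈ , refl ← ∈-map⁻ (zero ∷_) x∈ʳ
    with c , y , c∈ , y∈ , refl ← ∈-cartesianProductWith⁻ _∷_ (vertices highs) (words n) z∈
    = Adm-0∷ (sound-words n y∈)

  unique-resp : ∀ {A : Set} {xs ys : List A} → xs ↭ ys → Unique xs → Unique ys
  unique-resp p = Unique-resp-↭ (setoid _) (↭⇒↭ₛ p)

  unique-words : ∀ n → Unique (words n)
  unique-words zero       = [] ∷ []
  unique-words (suc zero) = unique-resp (↭-sym words-one)
    (Unique.cartesianProductWith⁺ _∷_ ∷-injective lows-unique (unique-words 0))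
  unique-words (suc (suc n)) = unique-resp (↭-sym (words-suc-suc n)) (Unique.++⁺
    (Unique.cartesianProductWith⁺ _∷_ ∷-injective lows-unique (unique-words (suc n)))
    (Unique.map⁺ ∷-injectiveʳ
      (Unique.cartesianProductWith⁺ _∷_ ∷-injective highs-unique (unique-words n)))
    disjoint)
    where
    -- In the high summand the second letter is high; in the low one the rest of the word is itself
    -- admissible, which would make that letter low.
    disjoint : ∀ {x} →
      x ∈ grid _∷_ (vertices lows) (words (suc n)) × x ∈ map (zero ∷_) (grid _∷_ HS (words n)) → ⊥
    disjoint (x∈ˡ , x∈ʳ)
      with _ , z∈ , refl ← ∈-map⁻ (zero ∷_) x∈ʳ
      with d , y , d∈ , y∈ , refl ← ∈-cartesianProductWith⁻ _∷_ (vertices highs) (words n) z∈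
      with _ , _ , _ , y∈′ , refl ← ∈-cartesianProductWith⁻ _∷_ (vertices lows) (words (suc n)) x∈ˡ
      = <⇒≱ (low (head-low (sound-words (suc n) y∈′))) (high d∈)

  -- From words to vertices of the cube

  attach : ∀ {n} {xs : List (Word a b n)} → All Adm xs → List (𝒮 a b n)
  attach = All.reduce (λ {x} adm → x , ⟦ adm ⟧)

  map-value-attach : ∀ {n} {xs : List (Word a b n)} (adms : All Adm xs) → map value (attach adms) ≡ xs
  map-value-attach []           = refl
  map-value-attach (adm ∷ adms) = cong (_ ∷_) (map-value-attach adms)

  hamiltonian : ∀ n → (∃₂ λ x z → Step Near z x × Path (Step Near) x z (words n)) →
    3 ≤ length (words n) → Hamiltonian (HoradamCube a b n)
  hamiltonian n (x , z , z~x , path w c) long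
    -- Admissibility is transported to the order of the walk, so that `attach` keeps the cyclic
    -- order.
    with All-resp-↭ (↭-sym c) (All.tabulate (sound-words n))
  ... | adms@(adm ∷ adms′) = record
    { start    = x , ⟦ adm ⟧
    ; rest     = attach adms′
    ; long     = subst (3 ≤_) (≡-trans (sym (↭-length c)) (≡-trans (cong length (sym values))
                   (length-map value (attach adms)))) long
    ; distinct = Unique.map⁻ (subst Unique (sym values) (unique-resp (↭-sym c) (unique-words n)))
    ; closed   = Linked.map⁻ (subst (Linked (λ x y → distance x y ≡ 1)) (sym (≡-trans
                   (map-++ value (attach adms) _) (cong (_∷ʳ x) values)))
                   (Linked.map Step⇒distance (Linked-vertices w z~x)))
    } , covered
    where
    open DecMembership (≡-dec (_≟ᶠ_ {a + b})) using (_∈?_)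
    values = map-value-attach adms
    covered : ∀ v → v ∈ attach adms
    -- The admissibility of a vertex is irrelevant, so the membership derived from it has to be
    -- recomputed by deciding it.
    covered u@(y , ⟦ adm-y ⟧)
      with v , v∈ , y≡ ← ∈-map⁻ value (subst (y ∈_) (sym values)
        (recompute (y ∈? vertices w) (∈-resp-↭ (↭-sym c) (complete-words y adm-y))))
      = subst (_∈ attach adms) (value-injective {v = v} {w = u} (sym y≡)) v∈

  hamiltonian-5+3j : ∀ j → Hamiltonian (HoradamCube a b (5 + j * 3))
  -- `cyclicPath n` needs an even count at length `n + 1` and yields length `n + 4`, so
  -- `n = 1 + j * 3`.
  hamiltonian-5+3j j = hamiltonian (5 + j * 3) (cyclicPath (1 + j * 3) (words-even j))
    (≤-trans (3≤words (1 + j * 3) (words-even j))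
      (≤-trans (length-words-mono (3 + j * 3)) (length-words-mono (4 + j * 3))))

theorem17 : ∀ (a b n k : ℕ) → 1 ≤ a → 1 ≤ b → parity a ≡ 1ℙ → parity b ≡ 1ℙ →
    2 ≤ k → n ≡ 3 * k ∸ 1 → Hamiltonian (HoradamCube a b n)
theorem17 _        _        _ 1             _ _ _     _     (s≤s ()) _
theorem17 (suc a′) (suc b′) _ (suc (suc j)) _ _ a-odd b-odd _        refl =
  -- With `k = 2 + j`, the length `(2 + j) * 3 ∸ 1` computes to `5 + j * 3`.
  subst (λ n → Hamiltonian (HoradamCube (suc a′) (suc b′) n)) (cong (_∸ 1) (*-comm (2 + j) 3))
    (Letters.hamiltonian-5+3j a′ b′ a-odd b-odd j)
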